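{- For every integer $n\geq 1$, the following identities hold in $\mathbb{Z}[x]$: $$F_n(x)= T_{n-1}(x)-\sum_{k=1}^{n-2}\bigl(xT_{n-1-k}(x)-2T_{n-2-k}(x)\bigr)F_k(x),$$ $$F_{n}(x)+xF_{n-1}(x)= U_{n-1}(x)-\sum_{k=1}^{n-2}\bigl(xU_{n-1-k}(x)-2U_{n-2-k}(x)\bigr)F_{k}(x).$$
   Context: The Chebyshev polynomials of the first kind $T_n(x)$ and of the second kind $U_n(x)$ are defined by $T_0(x)=1$, $T_1(x)=x$, $T_{n+1}(x)=2xT_n(x)-T_{n-1}(x)$, and $U_0(x)=1$, $U_1(x)=2x$, $U_{n+1}(x)=2xU_n(x)-U_{n-1}(x)$ for $n\ge 1$. The (Catalan) Fibonacci polynomials $F_n(x)$ are defined by $F_0(x)=0$, $F_1(x)=1$, $F_n(x)=xF_{n-1}(x)+F_{n-2}(x)$ for $n\geq 2$. A sum whose upper limit is smaller than its lower limit is $0$. -}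

module Defs where

open import Algebra.Bundles.Raw using (RawMonoid)
open import Data.Fin.Base using (toℕ)
open import Data.Integer.Base as ℤ using (ℤ; 0ℤ; 1ℤ; +_)
open import Data.List.Base using (List; []; _∷_; map)
open import Data.Nat.Base as ℕ using (ℕ; zero; suc; _∸_)
open import Relation.Binary.PropositionalEquality using (_≗_)

infix  4 _≈_
infixl 6 _+_ _-_
infixl 7 _*_
infix  8 -_

-- a₀ ∷ a₁ ∷ … ∷ aₘ ∷ [] stands for a₀ + a₁ x + … + aₘ xᵐ.  Trailing zeros are
-- allowed, so equality of polynomials is _≈_ rather than _≡_.
ℤ[x] : Set
ℤ[x] = List ℤ

coeff : ℤ[x] → ℕ → ℤ
coeff []      _       = 0ℤ
coeff (a ∷ p) zero    = a
coeff (a ∷ p) (suc i) = coeff p i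

_≈_ : ℤ[x] → ℤ[x] → Set
p ≈ q = coeff p ≗ coeff q

const : ℤ → ℤ[x]
const a = a ∷ []

0# 1# 2# x : ℤ[x]
0# = []
1# = const 1ℤ
2# = const (+ 2)
x  = 0ℤ ∷ 1ℤ ∷ []

_+_ : ℤ[x] → ℤ[x] → ℤ[x]
[]      + q       = q
(a ∷ p) + []      = a ∷ p
(a ∷ p) + (b ∷ q) = (a ℤ.+ b) ∷ (p + q)

-_ : ℤ[x] → ℤ[x]
- p = map ℤ.-_ p

_-_ : ℤ[x] → ℤ[x] → ℤ[x]
p - q = p + (- q)

-- (a + x p) q = a q + x (p q)
_*_ : ℤ[x] → ℤ[x] → ℤ[x]
[]      * q = []
(a ∷ p) * q = map (a ℤ.*_) q + (0ℤ ∷ (p * q))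

+-rawMonoid : RawMonoid _ _
+-rawMonoid = record { Carrier = ℤ[x] ; _≈_ = _≈_ ; _∙_ = _+_ ; ε = 0# }

open import Algebra.Definitions.RawMonoid +-rawMonoid using (sum)

-- f a + f (a + 1) + … + f b, which has suc b ∸ a terms and is 0# when b < a.
∑ : ℕ → ℕ → (ℕ → ℤ[x]) → ℤ[x]
∑ a b f = sum {suc b ∸ a} (λ i → f (a ℕ.+ toℕ i))

infix 5 ∑
syntax ∑ a b (λ k → p) = ∑[ k ∈ a ⋯ b ] p

T : ℕ → ℤ[x]
T 0             = 1#
T 1             = x
T (suc (suc n)) = 2# * x * T (suc n) - T n

U : ℕ → ℤ[x]
U 0             = 1#
U 1             = 2# * x
U (suc (suc n)) = 2# * x * U (suc n) - U n

F : ℕ → ℤ[x]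
F 0             = 0#
F 1             = 1#
F (suc (suc n)) = x * F (suc n) + F n

{-# OPTIONS --safe #-}

-- Both (Tₙ) and (Uₙ) solve Pₙ₊₂ = 2 x Pₙ₊₁ - Pₙ, that is, the inhomogeneous Fibonacci
-- recurrence Pₙ₊₂ = x Pₙ₊₁ + Pₙ + cₙ with cₙ = x Pₙ₊₁ - 2 Pₙ.  Hence
-- W j k = Pⱼ₊₁ Fₖ₊₁ + Pⱼ Fₖ satisfies W (j + 1) k = W j (k + 1) + cⱼ Fₖ₊₁, and telescoping
-- from W m 0 = Pₘ₊₁ to W 0 m gives both identities, for n = m + 2.
module Submission where

open import Algebra.Bundles using (CommutativeRing; RawRing)
import Algebra.Construct.Pointwise as Pointwise
import Algebra.Definitions.RawMonoid as RawMonoidDefinitions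
import Algebra.Morphism.RingMonomorphism as RingMonomorphism
open import Algebra.Morphism.Structures using (IsRingMonomorphism)
import Algebra.Properties.Group as GroupProperties
import Algebra.Solver.Ring as RingSolver
import Algebra.Solver.Ring.NaturalCoefficients.Default as NaturalCoefficients
open import Algebra.Solver.Ring.AlmostCommutativeRing
  using (fromCommutativeRing; _-Raw-AlmostCommutative⟶_)
open import Algebra.Structures using (IsCommutativeRing)
open import Data.Fin.Base using (toℕ)
open import Data.Integer.Base as ℤ using (ℤ; 0ℤ; 1ℤ; +_)
import Data.Integer.Properties as ℤ
open import Data.Integer.Tactic.RingSolver using (solve-∀)
open import Data.List.Base using ([]; _∷_; map)
open import Data.Maybe.Base as Maybe using (Maybe)
open import Data.Nat.Base as ℕ using (ℕ; zero; suc; _∸_; _≥_)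
open import Data.Product.Base using (_×_; _,_)
open import Function.Base using (_∘_)
open import Level using (0ℓ)
open import Relation.Binary.Consequences using (dec⇒weaklyDec)
open import Relation.Binary.PropositionalEquality
  using (_≡_; _≗_; refl; sym; trans; cong₂; module ≡-Reasoning)
import Relation.Binary.Reasoning.Setoid as ≈-Reasoning
open import Defs

-- Inhomogeneous Fibonacci recurrences

-- The source cⱼ is written c (j + 1) j: at c (m + 1 ∸ k) (m ∸ k) with k a successor, both
-- truncated subtractions compute, without any comparison of k with m.
module _ {a ℓ} (R : CommutativeRing a ℓ) (y : CommutativeRing.Carrier R)
  (c : ℕ → ℕ → CommutativeRing.Carrier R) (P : ℕ → CommutativeRing.Carrier R)
  where

  private module R = CommutativeRing R
  open R using (Carrier) renaming (_≈_ to _≋_; _+_ to _✚_; _*_ to _✱_; _-_ to _−_)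
  open NaturalCoefficients R.commutativeSemiring using (solve; _:=_; _:+_; _:*_)
  open RawMonoidDefinitions R.+-rawMonoid using (sum)
  open ≈-Reasoning R.setoid

  IsFibonacci : (ℕ → Carrier) → Set ℓ
  IsFibonacci G = ∀ n → G (2 ℕ.+ n) ≋ y ✱ G (suc n) ✚ G n

  -- With `k = suc (toℕ i)` the summand is the source of index `m - k` times `G k`, for `k` from 1
  -- to `m`; no subtraction truncates, as `toℕ i < m`.
  convolution : (ℕ → Carrier) → ℕ → Carrier
  convolution G m = sum {m} (λ i → c (m ∸ toℕ i) (m ∸ suc (toℕ i)) ✱ G (suc (toℕ i)))

  module _ (P-rec : ∀ n → P (2 ℕ.+ n) ≋ y ✱ P (suc n) ✚ P n ✚ c (suc n) n) where

    -- Stated for all solutions G of the Fibonacci recurrence, since the induction shifts G.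
    telescope : ∀ G → IsFibonacci G → ∀ m →
      P (suc m) ✱ G 1 ✚ P m ✱ G 0 ≋ P 1 ✱ G (suc m) ✚ P 0 ✱ G m ✚ convolution G m
    telescope G G-rec zero    = R.sym (R.+-identityʳ _)
    telescope G G-rec (suc m) = begin
      P (2 ℕ.+ m) ✱ G 1 ✚ P (suc m) ✱ G 0
        ≈⟨ R.+-congʳ (R.*-congʳ (P-rec m)) ⟩
      (y ✱ P (suc m) ✚ P m ✚ c (suc m) m) ✱ G 1 ✚ P (suc m) ✱ G 0
        ≈⟨ solve 6 (λ y p q d g h →
             (y :* p :+ q :+ d) :* g :+ p :* h := p :* (y :* g :+ h) :+ q :* g :+ d :* g)
             R.refl y (P (suc m)) (P m) (c (suc m) m) (G 1) (G 0) ⟩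
      P (suc m) ✱ (y ✱ G 1 ✚ G 0) ✚ P m ✱ G 1 ✚ c (suc m) m ✱ G 1
        ≈⟨ R.+-congʳ (R.+-congʳ (R.*-congˡ (G-rec 0))) ⟨
      P (suc m) ✱ G 2 ✚ P m ✱ G 1 ✚ c (suc m) m ✱ G 1
        -- Induction hypothesis for the shifted solution, which starts with `G 1` and `G 2`.
        ≈⟨ R.+-congʳ (telescope (G ∘ suc) (G-rec ∘ suc) m) ⟩
      P 1 ✱ G (2 ℕ.+ m) ✚ P 0 ✱ G (suc m) ✚ convolution (G ∘ suc) m ✚ c (suc m) m ✱ G 1
        ≈⟨ R.+-assoc _ _ _ ⟩
      P 1 ✱ G (2 ℕ.+ m) ✚ P 0 ✱ G (suc m) ✚ (convolution (G ∘ suc) m ✚ c (suc m) m ✱ G 1)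
        -- By definition, splitting the term `k = 1` off `convolution G (suc m)` leaves
        -- `convolution (G ∘ suc) m`.
        ≈⟨ R.+-congˡ (R.+-comm _ _) ⟩
      P 1 ✱ G (2 ℕ.+ m) ✚ P 0 ✱ G (suc m) ✚ convolution G (suc m) ∎

    -- The initial values 0 and 1 of `G` collapse the left side of `telescope` to `P (suc m)`.
    Fibonacci-expansion : ∀ G → G 0 ≋ R.0# → G 1 ≋ R.1# → IsFibonacci G → ∀ m →
      P 1 ✱ G (suc m) ✚ P 0 ✱ G m ≋ P (suc m) − convolution G m
    Fibonacci-expansion G G₀ G₁ G-rec m = x≈z//y _ _ _ (begin
      P 1 ✱ G (suc m) ✚ P 0 ✱ G m ✚ convolution G m   ≈⟨ telescope G G-rec m ⟨
      P (suc m) ✱ G 1 ✚ P m ✱ G 0                     ≈⟨ R.+-cong (R.*-congˡ G₁) (R.*-congˡ G₀) ⟩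
      P (suc m) ✱ R.1# ✚ P m ✱ R.0#                   ≈⟨ R.+-cong (R.*-identityʳ _) (R.zeroʳ _) ⟩
      P (suc m) ✚ R.0#                                ≈⟨ R.+-identityʳ _ ⟩
      P (suc m)                                       ∎)
      where open GroupProperties R.+-group using (x≈z//y)

-- The ring of formal power series

-- Polynomials are compared through their coefficients, so the ring laws are proved for arbitrary
-- coefficient functions, free of list shapes, and pulled back along `coeff`.
Series : Set
Series = ℕ → ℤ

infixl 6 _⊕_
infixl 7 _⊛_

-- `_⊛_` is the Cauchy product, obtained from `f = f 0 + x (f ∘ suc)`: the same recursion on the
-- left factor as in `_*_`.
_⊕_ _⊛_ : Series → Series → Series
(f ⊕ g) n = f n ℤ.+ g n
(f ⊛ g) zero    = f 0 ℤ.* g 0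
(f ⊛ g) (suc n) = f 0 ℤ.* g (suc n) ℤ.+ ((f ∘ suc) ⊛ g) n

0ˢ 1ˢ : Series
0ˢ _ = 0ℤ
1ˢ zero    = 1ℤ
1ˢ (suc _) = 0ℤ

⊛-cong : ∀ {f f′ g g′} → f ≗ f′ → g ≗ g′ → f ⊛ g ≗ f′ ⊛ g′
⊛-cong p q zero    = cong₂ ℤ._*_ (p 0) (q 0)
⊛-cong p q (suc n) =
  cong₂ ℤ._+_ (cong₂ ℤ._*_ (p 0) (q (suc n))) (⊛-cong (p ∘ suc) q n)

⊛-zeroˡ : ∀ g → 0ˢ ⊛ g ≗ 0ˢ
⊛-zeroˡ g zero    = refl
⊛-zeroˡ g (suc n) = trans (ℤ.+-identityˡ _) (⊛-zeroˡ g n)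

⊛-identityˡ : ∀ g → 1ˢ ⊛ g ≗ g
⊛-identityˡ g zero    = ℤ.*-identityˡ (g 0)
⊛-identityˡ g (suc n) =
  trans (cong₂ ℤ._+_ (ℤ.*-identityˡ (g (suc n))) (⊛-zeroˡ g n)) (ℤ.+-identityʳ _)

-- The definition splits off the summand containing `f 0`. Commutativity also needs the opposite
-- end, the summand containing `g 0`.
⊛-suc : ∀ f g n → (f ⊛ g) (suc n) ≡ (f ⊛ (g ∘ suc)) n ℤ.+ f (suc n) ℤ.* g 0
⊛-suc f g zero    = refl
⊛-suc f g (suc n) = trans
  (cong₂ ℤ._+_ (refl {x = f 0 ℤ.* g (suc (suc n))}) (⊛-suc (f ∘ suc) g n))
  (sym (ℤ.+-assoc (f 0 ℤ.* g (suc (suc n))) _ _))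

⊛-comm : ∀ f g → f ⊛ g ≗ g ⊛ f
⊛-comm f g zero    = ℤ.*-comm (f 0) (g 0)
⊛-comm f g (suc n) = begin
  f 0 ℤ.* g (suc n) ℤ.+ ((f ∘ suc) ⊛ g) n
    ≡⟨ cong₂ ℤ._+_ (ℤ.*-comm (f 0) _) (⊛-comm (f ∘ suc) g n) ⟩
  g (suc n) ℤ.* f 0 ℤ.+ (g ⊛ (f ∘ suc)) n
    ≡⟨ ℤ.+-comm (g (suc n) ℤ.* f 0) _ ⟩
  (g ⊛ (f ∘ suc)) n ℤ.+ g (suc n) ℤ.* f 0
    ≡⟨ ⊛-suc g f n ⟨
  (g ⊛ f) (suc n) ∎
  where open ≡-Reasoning

⊛-distribʳ : ∀ h f g → (f ⊕ g) ⊛ h ≗ (f ⊛ h) ⊕ (g ⊛ h)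
⊛-distribʳ h f g zero    = ℤ.*-distribʳ-+ (h 0) (f 0) (g 0)
⊛-distribʳ h f g (suc n) = trans
  (cong₂ ℤ._+_ (refl {x = (f 0 ℤ.+ g 0) ℤ.* h (suc n)}) (⊛-distribʳ h (f ∘ suc) (g ∘ suc) n))
  (rearrange (f 0) (g 0) (h (suc n)) _ _)
  where
  rearrange : ∀ a b c u v →
    (a ℤ.+ b) ℤ.* c ℤ.+ (u ℤ.+ v) ≡ (a ℤ.* c ℤ.+ u) ℤ.+ (b ℤ.* c ℤ.+ v)
  rearrange = solve-∀

⊛-distribˡ : ∀ h f g → h ⊛ (f ⊕ g) ≗ (h ⊛ f) ⊕ (h ⊛ g)
⊛-distribˡ h f g n = begin
  (h ⊛ (f ⊕ g)) n             ≡⟨ ⊛-comm h (f ⊕ g) n ⟩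
  ((f ⊕ g) ⊛ h) n             ≡⟨ ⊛-distribʳ h f g n ⟩
  (f ⊛ h) n ℤ.+ (g ⊛ h) n     ≡⟨ cong₂ ℤ._+_ (⊛-comm f h n) (⊛-comm g h n) ⟩
  (h ⊛ f) n ℤ.+ (h ⊛ g) n     ∎
  where open ≡-Reasoning

⊛-scaleˡ : ∀ a f g → ((a ℤ.*_) ∘ f) ⊛ g ≗ (a ℤ.*_) ∘ (f ⊛ g)
⊛-scaleˡ a f g zero    = ℤ.*-assoc a (f 0) (g 0)
⊛-scaleˡ a f g (suc n) = trans
  (cong₂ ℤ._+_ (refl {x = a ℤ.* f 0 ℤ.* g (suc n)}) (⊛-scaleˡ a (f ∘ suc) g n))
  (rearrange a (f 0) (g (suc n)) _)
  where
  rearrange : ∀ a b c u → a ℤ.* b ℤ.* c ℤ.+ a ℤ.* u ≡ a ℤ.* (b ℤ.* c ℤ.+ u)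
  rearrange = solve-∀

⊛-assoc : ∀ f g h → (f ⊛ g) ⊛ h ≗ f ⊛ (g ⊛ h)
⊛-assoc f g h zero    = ℤ.*-assoc (f 0) (g 0) (h 0)
⊛-assoc f g h (suc n) = begin
  -- The shift `(f ⊛ g) ∘ suc` is by definition `g ∘ suc` scaled by `f 0`, plus `(f ∘ suc) ⊛ g`;
  -- distributivity and `⊛-scaleˡ` then apply.
  f 0 ℤ.* g 0 ℤ.* h (suc n) ℤ.+ ((((f 0 ℤ.*_) ∘ g ∘ suc) ⊕ ((f ∘ suc) ⊛ g)) ⊛ h) n
    ≡⟨ cong₂ ℤ._+_ (refl {x = f 0 ℤ.* g 0 ℤ.* h (suc n)})
         (⊛-distribʳ h ((f 0 ℤ.*_) ∘ g ∘ suc) ((f ∘ suc) ⊛ g) n) ⟩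
  f 0 ℤ.* g 0 ℤ.* h (suc n)
    ℤ.+ ((((f 0 ℤ.*_) ∘ g ∘ suc) ⊛ h) n ℤ.+ (((f ∘ suc) ⊛ g) ⊛ h) n)
    ≡⟨ cong₂ ℤ._+_ (refl {x = f 0 ℤ.* g 0 ℤ.* h (suc n)})
         (cong₂ ℤ._+_ (⊛-scaleˡ (f 0) (g ∘ suc) h n) (⊛-assoc (f ∘ suc) g h n)) ⟩
  f 0 ℤ.* g 0 ℤ.* h (suc n)
    ℤ.+ (f 0 ℤ.* ((g ∘ suc) ⊛ h) n ℤ.+ ((f ∘ suc) ⊛ (g ⊛ h)) n)
    ≡⟨ rearrange (f 0) (g 0) (h (suc n)) _ _ ⟩
  f 0 ℤ.* (g 0 ℤ.* h (suc n) ℤ.+ ((g ∘ suc) ⊛ h) n) ℤ.+ ((f ∘ suc) ⊛ (g ⊛ h)) n ∎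
  where
  open ≡-Reasoning
  rearrange : ∀ a b c u v →
    a ℤ.* b ℤ.* c ℤ.+ (a ℤ.* u ℤ.+ v) ≡ a ℤ.* (b ℤ.* c ℤ.+ u) ℤ.+ v
  rearrange = solve-∀

seriesRawRing : RawRing 0ℓ 0ℓ
seriesRawRing = record
  { Carrier = Series ; _≈_ = _≗_ ; _+_ = _⊕_ ; _*_ = _⊛_ ; -_ = ℤ.-_ ∘_ ; 0# = 0ˢ ; 1# = 1ˢ }

series-isCommutativeRing : IsCommutativeRing _≗_ _⊕_ _⊛_ (ℤ.-_ ∘_) 0ˢ 1ˢ
series-isCommutativeRing = record
  { isRing = record
    { +-isAbelianGroup = Pointwise.isAbelianGroup ℕ ℤ.+-0-isAbelianGroup
    ; *-cong           = ⊛-cong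
    ; *-assoc          = ⊛-assoc
    ; *-identity       = ⊛-identityˡ , λ f n → trans (⊛-comm f 1ˢ n) (⊛-identityˡ f n)
    ; distrib          = ⊛-distribˡ , ⊛-distribʳ
    }
  ; *-comm = ⊛-comm
  }

-- The ring of polynomials

coeff-+ : ∀ p q → coeff (p + q) ≗ coeff p ⊕ coeff q
coeff-+ []      q       i       = sym (ℤ.+-identityˡ _)
coeff-+ (a ∷ p) []      i       = sym (ℤ.+-identityʳ _)
coeff-+ (a ∷ p) (b ∷ q) zero    = refl
coeff-+ (a ∷ p) (b ∷ q) (suc i) = coeff-+ p q i

coeff-neg : ∀ p → coeff (- p) ≗ (ℤ.-_) ∘ coeff p
coeff-neg []      i       = refl
coeff-neg (a ∷ p) zero    = refl
coeff-neg (a ∷ p) (suc i) = coeff-neg p i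

coeff-scale : ∀ a p → coeff (map (a ℤ.*_) p) ≗ (a ℤ.*_) ∘ coeff p
coeff-scale a []      i       = sym (ℤ.*-zeroʳ a)
coeff-scale a (b ∷ p) zero    = refl
coeff-scale a (b ∷ p) (suc i) = coeff-scale a p i

coeff-* : ∀ p q → coeff (p * q) ≗ coeff p ⊛ coeff q
coeff-* []      q i       = sym (⊛-zeroˡ (coeff q) i)
coeff-* (a ∷ p) q zero    = trans (coeff-+ (map (a ℤ.*_) q) _ 0)
  (trans (ℤ.+-identityʳ _) (coeff-scale a q 0))
coeff-* (a ∷ p) q (suc i) = trans (coeff-+ (map (a ℤ.*_) q) _ (suc i))
  (cong₂ ℤ._+_ (coeff-scale a q (suc i)) (coeff-* p q i))

coeff-1# : coeff 1# ≗ 1ˢ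
coeff-1# zero    = refl
coeff-1# (suc i) = refl

ℤ[x]-rawRing : RawRing 0ℓ 0ℓ
ℤ[x]-rawRing = record
  { Carrier = ℤ[x] ; _≈_ = _≈_ ; _+_ = _+_ ; _*_ = _*_ ; -_ = -_ ; 0# = 0# ; 1# = 1# }

-- Since `_≈_` is by definition equality of coefficient functions, congruence and injectivity are
-- identities.
coeff-isRingMonomorphism : IsRingMonomorphism ℤ[x]-rawRing seriesRawRing coeff
coeff-isRingMonomorphism = record
  { isRingHomomorphism = record
    { isSemiringHomomorphism = record
      { isNearSemiringHomomorphism = record
        { +-isMonoidHomomorphism = record
          { isMagmaHomomorphism = record
            { isRelHomomorphism = record { cong = λ p≈q → p≈q }
            ; homo              = coeff-+
            }
          ; ε-homo = λ _ → refl
          }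
        ; *-homo = coeff-*
        }
      ; 1#-homo = coeff-1#
      }
    ; -‿homo = coeff-neg
    }
  ; injective = λ p≈q → p≈q
  }

ℤ[x]-commutativeRing : CommutativeRing 0ℓ 0ℓ
ℤ[x]-commutativeRing = record
  { isCommutativeRing =
      RingMonomorphism.isCommutativeRing coeff-isRingMonomorphism series-isCommutativeRing
  }

module ℤ[x] = CommutativeRing ℤ[x]-commutativeRing

-- Makes integers the coefficients of the ring solver, so that `2#` is read as the number 2.
const-homomorphism : CommutativeRing.rawRing ℤ.+-*-commutativeRing
  -Raw-AlmostCommutative⟶ fromCommutativeRing ℤ[x]-commutativeRing
const-homomorphism = record
  { ⟦_⟧    = const
  ; +-homo = λ _ _ _ → refl
  ; *-homo = λ a b → λ { zero → sym (ℤ.+-identityʳ (a ℤ.* b)) ; (suc _) → refl }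
  ; -‿homo = λ _ _ → refl
  -- `const 0ℤ` is a list with one zero, whereas `0#` is empty.
  ; 0-homo = λ { zero → refl ; (suc _) → refl }
  ; 1-homo = λ _ → refl
  }

const-≟ : (a b : ℤ) → Maybe (const a ≈ const b)
const-≟ a b = Maybe.map (λ { refl _ → refl }) (dec⇒weaklyDec ℤ._≟_ a b)

-- Expansions for the Chebyshev recurrence

open RingSolver _ _ const-homomorphism const-≟
  using (solve; con; _:=_; _:+_; _:*_; _:-_)

-- Serves both kinds at once: `T` and `U` share the recurrence and differ only in `P 1`.
Chebyshev-expansion : (P : ℕ → ℤ[x]) → (∀ n → P (2 ℕ.+ n) ≈ 2# * x * P (suc n) - P n) →
  ∀ m → P 1 * F (suc m) + P 0 * F m
      ≈ P (suc m) - (∑[ k ∈ 1 ⋯ m ] ((x * P (suc m ∸ k) - 2# * P (m ∸ k)) * F k))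
Chebyshev-expansion P P-rec =
  -- For this source the sum over `1 ⋯ m` unfolds to `convolution F m`.
  Fibonacci-expansion ℤ[x]-commutativeRing x (λ i j → x * P i - 2# * P j) P
    P-rec′ F (λ _ → refl) (λ _ → refl) (λ _ _ → refl)
  where
  open ≈-Reasoning ℤ[x].setoid
  P-rec′ : ∀ n → P (2 ℕ.+ n) ≈ x * P (suc n) + P n + (x * P (suc n) - 2# * P n)
  P-rec′ n = begin
    P (2 ℕ.+ n)
      ≈⟨ P-rec n ⟩
    2# * x * P (suc n) - P n
      ≈⟨ solve 3 (λ x p q → con (+ 2) :* x :* p :- q
           := x :* p :+ q :+ (x :* p :- con (+ 2) :* q)) (λ _ → refl) x (P (suc n)) (P n) ⟩
    x * P (suc n) + P n + (x * P (suc n) - 2# * P n) ∎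

theorem1 : (n : ℕ) → n ≥ 1 →
    (F n ≈ T (n ∸ 1) - (∑[ k ∈ 1 ⋯ n ∸ 2 ] ((x * T (n ∸ 1 ∸ k) - 2# * T (n ∸ 2 ∸ k)) * F k)))
    × (F n + x * F (n ∸ 1) ≈ U (n ∸ 1) - (∑[ k ∈ 1 ⋯ n ∸ 2 ] ((x * U (n ∸ 1 ∸ k) - 2# * U (n ∸ 2 ∸ k)) * F k)))
-- Both sums are empty. In the second identity `x * 0#` is a list of zeros, which leaves a trailing
-- zero, hence the cases on the coefficient index.
theorem1 (suc zero)    _ = (λ _ → refl) , λ { zero → refl ; (suc zero) → refl ; (suc (suc _)) → refl }
theorem1 (suc (suc m)) _ =
    (begin
      x * F (suc m) + F m
        -- Exhibits `T 1 = x` and `T 0 = 1#` as the factors.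
        ≈⟨ solve 3 (λ x f g → x :* f :+ g := x :* f :+ con 1ℤ :* g)
             (λ _ → refl) x (F (suc m)) (F m) ⟩
      x * F (suc m) + 1# * F m
        ≈⟨ Chebyshev-expansion T (λ _ _ → refl) m ⟩
      T (suc m) - (∑[ k ∈ 1 ⋯ m ] ((x * T (suc m ∸ k) - 2# * T (m ∸ k)) * F k)) ∎)
  , (begin
      x * F (suc m) + F m + x * F (suc m)
        -- The extra `x * F (suc m)` doubles the first factor to `U 1 = 2# * x`.
        ≈⟨ solve 3 (λ x f g → x :* f :+ g :+ x :* f := con (+ 2) :* x :* f :+ con 1ℤ :* g)
             (λ _ → refl) x (F (suc m)) (F m) ⟩
      2# * x * F (suc m) + 1# * F m
        ≈⟨ Chebyshev-expansion U (λ _ _ → refl) m ⟩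
      U (suc m) - (∑[ k ∈ 1 ⋯ m ] ((x * U (suc m ∸ k) - 2# * U (m ∸ k)) * F k)) ∎)
  where open ≈-Reasoning ℤ[x].setoid
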